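{- Let $U$ be an infinite binary information system from the class $W_3^l$. Then: (a) The system $U$ is $ld$-reachable. (b) The system $U$ is $la$-reachable.
   Context: $\mathbb{N}=\{1,2,\ldots\}$. An infinite binary information system is a pair $U=(A,F)$ where $A$ is an infinite set (of objects) and $F$ is an infinite set of functions $A\to\{0,1\}$ (attributes). A problem over $U$ is a tuple $z=(\nu,f_1,\ldots,f_n)$ with $n\in\mathbb{N}$, $\nu:\{0,1\}^n\to\mathbb{N}$ and $f_1,\ldots,f_n\in F$ (not necessarily distinct); $z(a)=\nu(f_1(a),\ldots,f_n(a))$ for $a\in A$, and $\dim z=n$. Decision trees. A decision tree over $U$ is a finite directed rooted tree in which the root and the edges leaving the root are unlabeled, each terminal node is labeled with a number from $\mathbb{N}$, each working node (neither the root nor terminal) is labeled with an attribute from $F$, and each edge leaving a working node is labeled with a number from $\{0,1\}$ (the root is not terminal; several edges leaving the same working node may carry the same label). It is deterministic if exactly one edge leaves the root and edges leaving any working node have different labels. A complete path $\xi$ is a directed path from the root to a terminal node; $A(\xi)$ is the set of all $a\in A$ such that, for each working node of $\xi$, labeled with attribute $f$ and followed in $\xi$ by an edge labeled $\delta$, one has $f(a)=\delta$ ($A(\xi)=A$ if $\xi$ has no working nodes). The depth $h(\Gamma)$ is the maximum number of working nodes in a complete path of $\Gamma$; $L(\Gamma)$ is the number of all nodes of $\Gamma$, including the root. $\Gamma$ is a decision tree over the problem $z=(\nu,f_1,\ldots,f_n)$ if all its working nodes are labeled with attributes from $\{f_1,\ldots,f_n\}$. A decision tree $\Gamma$ over $z$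 solves $z$ nondeterministically if for every $a\in A$ there is a complete path $\xi$ with $a\in A(\xi)$, and for every $a\in A$ and every complete path $\xi$ with $a\in A(\xi)$ the terminal node of $\xi$ is labeled $z(a)$. It solves $z$ deterministically if, in addition, $\Gamma$ is deterministic. Complexity functions. $h_U^{ld}(z)$ and $L_U^{ld}(z)$ (resp. $h_U^{la}(z)$ and $L_U^{la}(z)$) are the minimum depth and the minimum number of nodes of a decision tree over $z$ solving $z$ deterministically (resp. nondeterministically). For $n\in\mathbb{N}$, $h_U^{ld}(n)$, $h_U^{la}(n)$, $L_U^{ld}(n)$, $L_U^{la}(n)$ are the maxima of $h_U^{ld}(z)$, $h_U^{la}(z)$, $L_U^{ld}(z)$, $L_U^{la}(z)$, respectively, over all problems $z$ over $U$ with $\dim z\le n$. Class $W_3^l$: all infinite binary information systems $U$ of local type (LIN, LIN, EXP, EXP), i.e. such that $h_U^{ld}(n)=n$, $h_U^{la}(n)=n$, $L_U^{ld}(n)=2^{n+1}$ and $L_U^{la}(n)=2^{n+1}$ for all $n\in\mathbb{N}$. Boundary pairs and reachability. A pair $(\varphi,\psi)$ of functions $\mathbb{N}\to\mathbb{N}\cup\{0\}$ is a boundary $ld$-pair (resp. boundary $la$-pair) of $U$ if for every problem $z$ over $U$ there is a decision tree $\Gamma$ over $z$ which solves $z$ deterministically (resp. nondeterministically) with $h(\Gamma)\le\varphi(n)$ and $L(\Gamma)\le\psi(n)$, where $n=\dim z$. $U$ is $ld$-reachable if $(h_U^{ld},L_U^{ld})$ is a boundary $ld$-pair of $U$, and $la$-reachable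 if $(h_U^{la},L_U^{la})$ is a boundary $la$-pair of $U$. -}

module Defs where

open import Data.Bool.Base using (Bool)
open import Data.List.Base using (List; []; _∷_; map)
open import Data.List.Membership.Propositional using (_∈_)
open import Data.List.NonEmpty.Base using (List⁺; _∷_; toList; length)
open import Data.List.Relation.Unary.All using (All)
open import Data.List.Relation.Unary.Any using (here; there)
import Data.List.Relation.Unary.Enumerates.Setoid as Enumerates
open import Data.List.Relation.Unary.Unique.Propositional using (Unique)
open import Data.Nat.ListAction using (sum)
open import Data.Nat.Base using (ℕ; suc; _+_; _⊔_; _^_; _≤_; NonZero; z≤n; s≤s)
open import Data.Nat.Properties using (m≤m⊔n; m≤n⇒m≤o⊔n; ≤-trans; ⊔-identityʳ; ⊔-sel)
open import Data.Product.Base using (Σ; ∃; ∃-syntax; _×_; _,_; proj₁; proj₂)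
open import Data.Refinement.Base using (Refinement-syntax; value)
open import Data.Sum.Base using (inj₁; inj₂)
open import Data.Unit.Base using (⊤)
open import Data.Vec.Base as Vec using (Vec)
import Data.Vec.Membership.Setoid as VecMembership
open import Level using (Level; 0ℓ) renaming (suc to lsuc; _⊔_ to _⊔ˡ_)
open import Relation.Binary.Bundles using (Setoid)
import Relation.Binary.Construct.On as On
open import Relation.Binary.PropositionalEquality
  using (_≡_; refl; sym; trans; cong; setoid; _→-setoid_)
open import Relation.Nullary.Negation using (¬_)
open import Relation.Unary using (Pred)

ℕ⁺ : Set
ℕ⁺ = [ n ∈ ℕ ∣ NonZero n ]

-- "k is the minimum (maximum) of P" is a relation rather than an operation:
-- without excluded middle the least element of an arbitrary inhabited set of
-- numbers cannot be computed.

IsMinimum : ∀ {p} → Pred ℕ p → ℕ → Set p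
IsMinimum P k = P k × (∀ m → P m → k ≤ m)

IsMaximum : ∀ {p} → Pred ℕ p → ℕ → Set p
IsMaximum P k = P k × (∀ m → P m → m ≤ k)

Infinite : ∀ {c ℓ} → Setoid c ℓ → Set (c ⊔ˡ ℓ)
Infinite S = ¬ ∃ (Enumerates.IsEnumeration S)

-- Elements of a set of functions, compared pointwise; the proof of membership
-- is ignored.

functionsIn : ∀ {a f} {A : Set a} → Pred (A → Bool) f → Setoid (a ⊔ˡ f) a
functionsIn {A = A} F = On.setoid {B = Σ (A → Bool) F} (A →-setoid Bool) proj₁

record InfiniteBinaryInformationSystem (a f : Level) : Set (lsuc (a ⊔ˡ f)) where
  field
    A          : Set a
    F          : Pred (A → Bool) f
    A-infinite : Infinite (setoid A)
    F-infinite : Infinite (functionsIn F)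

data Mode : Set where
  deterministic nondeterministic : Mode

module _ {a f : Level} (U : InfiniteBinaryInformationSystem a f) where
  open InfiniteBinaryInformationSystem U

  Attribute : Set (a ⊔ˡ f)
  Attribute = Σ (A → Bool) F

  open VecMembership (functionsIn F) using () renaming (_∈_ to _∈ᵛ_)

  record Problem : Set (a ⊔ˡ f) where
    constructor problem
    field
      dim        : ℕ⁺
      ν          : Vec Bool (value dim) → ℕ⁺
      attributes : Vec Attribute (value dim)

    answer : A → ℕ⁺
    answer x = ν (Vec.map (λ g → proj₁ g x) attributes)

  open Problem

  -- A node other than the root, together with everything below it. Only
  -- terminal nodes have no outgoing edges, hence the nonempty lists; the order
  -- of siblings is irrelevant to all notions below.

  data Node : Set (a ⊔ˡ f) where
    terminal : ℕ⁺ → Node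
    working  : Attribute → List⁺ (Bool × Node) → Node

  data DecisionTree : Set (a ⊔ˡ f) where
    root : List⁺ Node → DecisionTree

  data PathFrom : Node → Set (a ⊔ˡ f) where
    stop : ∀ {k} → PathFrom (terminal k)
    step : ∀ {g es δ t} → (δ , t) ∈ toList es → PathFrom t → PathFrom (working g es)

  data CompletePath : DecisionTree → Set (a ⊔ˡ f) where
    start : ∀ {ts t} → t ∈ toList ts → PathFrom t → CompletePath (root ts)

  labelFrom : ∀ {t} → PathFrom t → ℕ⁺
  labelFrom (stop {k}) = k
  labelFrom (step _ p) = labelFrom p

  terminalLabel : ∀ {Γ} → CompletePath Γ → ℕ⁺
  terminalLabel (start _ p) = labelFrom p

  #workingFrom : ∀ {t} → PathFrom t → ℕ
  #workingFrom stop       = 0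
  #workingFrom (step _ p) = suc (#workingFrom p)

  #working : ∀ {Γ} → CompletePath Γ → ℕ
  #working (start _ p) = #workingFrom p

  Follows : ∀ {t} → PathFrom t → Pred A 0ℓ
  Follows stop                   x = ⊤
  Follows (step {g} {δ = δ} _ p) x = proj₁ g x ≡ δ × Follows p x

  A[_] : ∀ {Γ} → CompletePath Γ → Pred A 0ℓ
  A[ start _ p ] = Follows p

  nodeDepth  : Node → ℕ
  edgesDepth : List (Bool × Node) → ℕ

  nodeDepth (terminal _)               = 0
  nodeDepth (working _ ((_ , t) ∷ es)) = suc (nodeDepth t ⊔ edgesDepth es)

  edgesDepth []             = 0
  edgesDepth ((_ , t) ∷ es) = nodeDepth t ⊔ edgesDepth es

  nodesDepth : List Node → ℕ
  nodesDepth []       = 0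
  nodesDepth (t ∷ ts) = nodeDepth t ⊔ nodesDepth ts

  -- See depth-isMaximum.
  depth : DecisionTree → ℕ
  depth (root (t ∷ ts)) = nodeDepth t ⊔ nodesDepth ts

  nodeSize  : Node → ℕ
  edgesSize : List (Bool × Node) → ℕ

  nodeSize (terminal _)               = 1
  nodeSize (working _ ((_ , t) ∷ es)) = suc (nodeSize t + edgesSize es)

  edgesSize []             = 0
  edgesSize ((_ , t) ∷ es) = nodeSize t + edgesSize es

  -- The root is counted.
  size : DecisionTree → ℕ
  size (root ts) = suc (sum (map nodeSize (toList ts)))

  data DistinctEdges : Node → Set (a ⊔ˡ f) where
    terminal : ∀ {k} → DistinctEdges (terminal k)
    working  : ∀ {g es} → Unique (map proj₁ (toList es)) →
               All (λ e → DistinctEdges (proj₂ e)) (toList es) →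
               DistinctEdges (working g es)

  Deterministic : DecisionTree → Set (a ⊔ˡ f)
  Deterministic (root ts) = length ts ≡ 1 × All DistinctEdges (toList ts)

  data UsesOnly {n} (gs : Vec Attribute n) : Node → Set (a ⊔ˡ f) where
    terminal : ∀ {k} → UsesOnly gs (terminal k)
    working  : ∀ {g es} → g ∈ᵛ gs →
               All (λ e → UsesOnly gs (proj₂ e)) (toList es) →
               UsesOnly gs (working g es)

  _IsTreeOver_ : DecisionTree → Problem → Set (a ⊔ˡ f)
  root ts IsTreeOver z = All (UsesOnly (attributes z)) (toList ts)

  SolvesNondeterministically : DecisionTree → Problem → Set (a ⊔ˡ f)
  SolvesNondeterministically Γ z =
      (∀ x → ∃ λ (ξ : CompletePath Γ) → A[ ξ ] x)
    × (∀ x (ξ : CompletePath Γ) → A[ ξ ] x → terminalLabel ξ ≡ answer z x)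

  Solves : Mode → DecisionTree → Problem → Set (a ⊔ˡ f)
  Solves nondeterministic Γ z = SolvesNondeterministically Γ z
  Solves deterministic    Γ z = Deterministic Γ × SolvesNondeterministically Γ z

  -- IsProblemDepth m z k says that k = h(z), and IsProblemSize m z k that
  -- k = L(z), for the given mode of solving.

  IsProblemDepth : Mode → Problem → ℕ → Set (a ⊔ˡ f)
  IsProblemDepth m z =
    IsMinimum (λ k → ∃[ Γ ] Γ IsTreeOver z × Solves m Γ z × depth Γ ≡ k)

  IsProblemSize : Mode → Problem → ℕ → Set (a ⊔ˡ f)
  IsProblemSize m z =
    IsMinimum (λ k → ∃[ Γ ] Γ IsTreeOver z × Solves m Γ z × size Γ ≡ k)

  -- Likewise k = h(n) and k = L(n).

  IsSystemDepth : Mode → ℕ⁺ → ℕ → Set (a ⊔ˡ f)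
  IsSystemDepth m n =
    IsMaximum (λ k → ∃[ z ] value (dim z) ≤ value n × IsProblemDepth m z k)

  IsSystemSize : Mode → ℕ⁺ → ℕ → Set (a ⊔ˡ f)
  IsSystemSize m n =
    IsMaximum (λ k → ∃[ z ] value (dim z) ≤ value n × IsProblemSize m z k)

  record W₃ˡ : Set (a ⊔ˡ f) where
    field
      h-ld : ∀ n → IsSystemDepth deterministic    n (value n)
      h-la : ∀ n → IsSystemDepth nondeterministic n (value n)
      L-ld : ∀ n → IsSystemSize  deterministic    n (2 ^ suc (value n))
      L-la : ∀ n → IsSystemSize  nondeterministic n (2 ^ suc (value n))

  IsBoundaryPair : Mode → (φ ψ : ℕ⁺ → ℕ) → Set (a ⊔ˡ f)
  IsBoundaryPair m φ ψ =
    ∀ z → ∃[ Γ ] Γ IsTreeOver z × Solves m Γ z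
               × depth Γ ≤ φ (dim z) × size Γ ≤ ψ (dim z)

  -- The pair (φ , ψ) is unique pointwise, as maxima are; requiring it to exist
  -- keeps the notion from holding vacuously.

  Reachable : Mode → Set (a ⊔ˡ f)
  Reachable m = ∃[ φ ] ∃[ ψ ]
      (∀ n → IsSystemDepth m n (φ n))
    × (∀ n → IsSystemSize m n (ψ n))
    × IsBoundaryPair m φ ψ

  private
    edge≤ : ∀ {δ t} es → (δ , t) ∈ es → nodeDepth t ≤ edgesDepth es
    edge≤ (_ ∷ _)        (here refl) = m≤m⊔n _ _
    edge≤ ((_ , t) ∷ es) (there i)   = m≤n⇒m≤o⊔n (nodeDepth t) (edge≤ es i)

    node≤ : ∀ {t} ts → t ∈ ts → nodeDepth t ≤ nodesDepth ts
    node≤ (_ ∷ _)  (here refl) = m≤m⊔n _ _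
    node≤ (t ∷ ts) (there i)   = m≤n⇒m≤o⊔n (nodeDepth t) (node≤ ts i)

    path≤ : ∀ {t} (p : PathFrom t) → #workingFrom p ≤ nodeDepth t
    path≤ stop = z≤n
    path≤ (step {es = e ∷ es} i p) = s≤s (≤-trans (path≤ p) (edge≤ (e ∷ es) i))

    deepest     : ∀ t → ∃[ p ] #workingFrom {t} p ≡ nodeDepth t
    deepestEdge : ∀ δ t es → ∃[ δ′ ] ∃[ t′ ] (δ′ , t′) ∈ (δ , t) ∷ es ×
                  ∃[ p ] #workingFrom {t′} p ≡ nodeDepth t ⊔ edgesDepth es

    deepest (terminal _) = stop , refl
    deepest (working _ ((δ , t) ∷ es)) with deepestEdge δ t es
    ... | _ , _ , i , p , eq = step i p , cong suc eq

    deepestEdge δ t [] with deepest t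
    ... | p , eq = δ , t , here refl , p , trans eq (sym (⊔-identityʳ _))
    deepestEdge δ t ((δ′ , t′) ∷ es)
      with ⊔-sel (nodeDepth t) (nodeDepth t′ ⊔ edgesDepth es)
    ... | inj₁ left with deepest t
    ...   | p , eq = δ , t , here refl , p , trans eq (sym left)
    deepestEdge δ t ((δ′ , t′) ∷ es) | inj₂ right with deepestEdge δ′ t′ es
    ...   | _ , _ , i , p , eq = _ , _ , there i , p , trans eq (sym right)

    deepestNode : ∀ t ts → ∃[ t′ ] t′ ∈ t ∷ ts ×
                  ∃[ p ] #workingFrom {t′} p ≡ nodeDepth t ⊔ nodesDepth ts
    deepestNode t [] with deepest t
    ... | p , eq = t , here refl , p , trans eq (sym (⊔-identityʳ _))
    deepestNode t (t′ ∷ ts) with ⊔-sel (nodeDepth t) (nodeDepth t′ ⊔ nodesDepth ts)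
    ... | inj₁ left with deepest t
    ...   | p , eq = t , here refl , p , trans eq (sym left)
    deepestNode t (t′ ∷ ts) | inj₂ right with deepestNode t′ ts
    ...   | _ , i , p , eq = _ , there i , p , trans eq (sym right)

  depth-isMaximum : ∀ Γ → IsMaximum (λ k → ∃ λ (ξ : CompletePath Γ) → #working ξ ≡ k) (depth Γ)
  depth-isMaximum (root (t ∷ ts)) = attained , upper
    where
    attained : ∃ λ (ξ : CompletePath (root (t ∷ ts))) → #working ξ ≡ depth (root (t ∷ ts))
    attained with deepestNode t ts
    ... | _ , i , p , eq = start i p , eq

    upper : ∀ k → ∃ (λ (ξ : CompletePath (root (t ∷ ts))) → #working ξ ≡ k) →
            k ≤ depth (root (t ∷ ts))
    upper _ (start i p , refl) = ≤-trans (path≤ p) (node≤ (t ∷ ts) i)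

-- Testing all n attributes of a problem one after another gives the complete
-- binary tree, which solves the problem deterministically with depth n and
-- 1 + (2ⁿ⁺¹ − 1) nodes, the first summand being the root. In W₃ˡ these are the
-- values of h(n) and L(n) in both modes, so the complete tree attains both
-- bounds at once.

module Submission where

open import Defs
open import Data.Bool.Base using (Bool; true; false)
open import Data.List.Base using ([]; _∷_)
open import Data.List.NonEmpty.Base using (_∷_)
open import Data.List.Relation.Unary.All using ([]; _∷_)
open import Data.List.Relation.Unary.AllPairs using ([]; _∷_)
open import Data.List.Relation.Unary.Any using (here; there)
open import Data.Nat.Base using (suc; _+_; _⊔_; _^_)
open import Data.Nat.Properties
  using (+-identityʳ; +-suc; ⊔-idem; ⊔-identityʳ; ≤-reflexive)
open import Data.Product.Base using (∃; _×_; _,_; proj₁)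
open import Data.Refinement.Base using (value)
open import Data.Vec.Base as Vec using (Vec; []; _∷_)
import Data.Vec.Membership.Setoid as VecMembership
import Data.Vec.Relation.Unary.Any as VecAny
open import Data.Unit.Base using (tt)
open import Function.Base using (_∘_; id)
open import Relation.Binary.PropositionalEquality
  using (_≡_; refl; sym; trans; cong; cong₂)

module _ {a f} (U : InfiniteBinaryInformationSystem a f) where
  open InfiniteBinaryInformationSystem U
  open VecMembership (functionsIn F) using () renaming (_∈_ to _∈ᵛ_)
  open Problem

  -- Specialising `ν` to the outcomes seen so far makes the recursion structural. A repeated
  -- attribute is tested again; this only adds branches that no object follows.
  completeNode : ∀ {n} → Vec (Attribute U) n → (Vec Bool n → ℕ⁺) → Node U
  completeNode []       ν = terminal (ν [])
  completeNode (g ∷ gs) ν = working g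
    ( (false , completeNode gs (ν ∘ (false ∷_)))
    ∷ (true  , completeNode gs (ν ∘ (true ∷_)))
    ∷ [])

  completeTree : Problem U → DecisionTree U
  completeTree z = root (completeNode (attributes z) (ν z) ∷ [])

  completeNode-depth : ∀ {n} (gs : Vec (Attribute U) n) ν →
                       nodeDepth U (completeNode gs ν) ≡ n
  completeNode-depth []       ν = refl
  completeNode-depth (g ∷ gs) ν = cong suc (trans
    (cong₂ _⊔_ (completeNode-depth gs _)
               (trans (⊔-identityʳ _) (completeNode-depth gs _)))
    (⊔-idem _))

  -- The outer `suc` stands for the root. It also turns `2 ^ suc n` minus one into a pure power,
  -- which doubles at each level.
  completeNode-size : ∀ {n} (gs : Vec (Attribute U) n) ν →
                      suc (nodeSize U (completeNode gs ν)) ≡ 2 ^ suc n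
  completeNode-size []       ν = refl
  completeNode-size (g ∷ gs) ν = trans
    -- The node's own unit is moved to the second subtree, so that each subtree has the `suc` its
    -- induction hypothesis asks for.
    (cong suc (sym (+-suc _ _)))
    (cong₂ _+_ (completeNode-size gs _)
               (trans (cong suc (+-identityʳ _))
                      (trans (completeNode-size gs _) (sym (+-identityʳ _)))))

  completeNode-distinctEdges : ∀ {n} (gs : Vec (Attribute U) n) ν →
                               DistinctEdges U (completeNode gs ν)
  completeNode-distinctEdges []       ν = terminal
  completeNode-distinctEdges (g ∷ gs) ν = working
    (((λ ()) ∷ []) ∷ [] ∷ [])
    (completeNode-distinctEdges gs _ ∷ completeNode-distinctEdges gs _ ∷ [])

  -- The list `hs` stays fixed while `gs` shrinks along the recursion, hence the inclusion as an
  -- invariant.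
  completeNode-usesOnly : ∀ {m n} {hs : Vec (Attribute U) m} (gs : Vec (Attribute U) n) ν →
                          (∀ g → g ∈ᵛ gs → g ∈ᵛ hs) →
                          UsesOnly U hs (completeNode gs ν)
  completeNode-usesOnly []       ν gs⊆hs = terminal
  completeNode-usesOnly (g ∷ gs) ν gs⊆hs = working
    (gs⊆hs g (VecAny.here λ _ → refl))
    ( completeNode-usesOnly gs _ (λ h → gs⊆hs h ∘ VecAny.there)
    ∷ completeNode-usesOnly gs _ (λ h → gs⊆hs h ∘ VecAny.there)
    ∷ [])

  -- Both values have an edge at every working node, so the values of the attributes at `x` lead to
  -- a terminal node.
  completeNode-path : ∀ {n} (gs : Vec (Attribute U) n) ν x →
                      ∃ λ (p : PathFrom U (completeNode gs ν)) → Follows U p x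
  completeNode-path []       ν x = stop , tt
  completeNode-path (g ∷ gs) ν x with proj₁ g x in eq
  ... | false with p , follows ← completeNode-path gs (ν ∘ (false ∷_)) x =
    step (here refl) p , eq , follows
  ... | true  with p , follows ← completeNode-path gs (ν ∘ (true ∷_)) x =
    step (there (here refl)) p , eq , follows

  completeNode-label : ∀ {n} (gs : Vec (Attribute U) n) ν x
                       (p : PathFrom U (completeNode gs ν)) → Follows U p x →
                       labelFrom U p ≡ ν (Vec.map (λ g → proj₁ g x) gs)
  completeNode-label []       ν x stop _ = refl
  -- By `eq` the first argument bit of `ν` is the edge label, which is how `ν` was specialised in
  -- this subtree.
  completeNode-label (g ∷ gs) ν x (step (here refl) p) (eq , follows)
    rewrite eq = completeNode-label gs _ x p follows
  completeNode-label (g ∷ gs) ν x (step (there (here refl)) p) (eq , follows)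
    rewrite eq = completeNode-label gs _ x p follows

  completeTree-solves : ∀ m z → Solves U m (completeTree z) z
  completeTree-solves nondeterministic z = covers , correct
    where
    covers : ∀ x → ∃ λ (ξ : CompletePath U (completeTree z)) → A[_] U ξ x
    covers x with p , follows ← completeNode-path (attributes z) (ν z) x =
      start (here refl) p , follows

    correct : ∀ x (ξ : CompletePath U (completeTree z)) → A[_] U ξ x →
              terminalLabel U ξ ≡ answer z x
    correct x (start (here refl) p) follows =
      completeNode-label (attributes z) (ν z) x p follows
  completeTree-solves deterministic z =
    (refl , completeNode-distinctEdges (attributes z) (ν z) ∷ []) ,
    completeTree-solves nondeterministic z

  complete-isBoundaryPair : ∀ m → IsBoundaryPair U m value (λ n → 2 ^ suc (value n))
  complete-isBoundaryPair m z =
      completeTree z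
    , completeNode-usesOnly (attributes z) (ν z) (λ _ → id) ∷ []
    , completeTree-solves m z
    -- Both bounds are equalities; the neutral zeros come from the empty list of further children of
    -- the root.
    , ≤-reflexive (trans (⊔-identityʳ _) (completeNode-depth (attributes z) (ν z)))
    , ≤-reflexive (trans (cong suc (+-identityʳ _))
                         (completeNode-size (attributes z) (ν z)))

theorem4 : ∀ {a f} (U : InfiniteBinaryInformationSystem a f) → W₃ˡ U →
    Reachable U deterministic × Reachable U nondeterministic
theorem4 U w =
    -- The omitted pair is `value` and `2 ^ suc (value n)`, the values prescribed by the class.
    (_ , _ , h-ld , L-ld , complete-isBoundaryPair U deterministic)
  , (_ , _ , h-la , L-la , complete-isBoundaryPair U nondeterministic)
  where open W₃ˡ w
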